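{- Let $A,B$ be sets, $L\colon A^*\rightharpoonup B^*$ a partial function (regarded as an element of $(B^*+1)^{A^*}$), and $\mathcal{L}_{\mathsf{Kl}(\mathcal{T})}\colon\mathcal{O}_{\mathsf{word}}\to\mathsf{Kl}(\mathcal{T})$ the corresponding $(\mathsf{Kl}(\mathcal{T}),1,1)$-language. Let $\mathcal{A}^{\mathit{final}}(\mathcal{L}_{\mathsf{Kl}(\mathcal{T})})\colon\mathcal{I}_{\mathsf{word}}\to\mathsf{Kl}(\mathcal{T})$ be the automaton sending $\mathsf{in}$ and $\mathsf{out}$ to $1$, $\mathsf{states}$ to $\mathsf{Irr}(A^*,B^*)$, and defined on generating arrows by - $\triangleright\mapsto\big(1\nrightarrow\mathsf{Irr}(A^*,B^*)\big)$, $0\mapsto(\mathsf{lcp}(L),\mathsf{red}(L))$ if $L\neq\kappa_\bot$, and $0\mapsto\bot$ if $L=\kappa_\bot$; - $\triangleleft\mapsto\big(\mathsf{Irr}(A^*,B^*)\nrightarrow 1\big)$, $K\mapsto K(\varepsilon)$; - for $a\in A$, $a\mapsto\big(\mathsf{Irr}(A^*,B^*)\nrightarrow\mathsf{Irr}(A^*,B^*)\big)$, $K\mapsto\bot$ if $a^{ -1}K=\kappa_\bot$, and $K\mapsto(\mathsf{lcp}(a^{ -1}K),\mathsf{red}(a^{ -1}K))$ otherwise. Then $\mathcal{A}^{\mathit{final}}(\mathcal{L}_{\mathsf{Kl}(\mathcal{T})})$ is a final object of $\mathsf{Auto}(\mathcal{L}_{\mathsf{Kl}(\mathcal{T})})$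.
   Context: The category $\mathcal{I}_{\mathsf{word}}$ has objects $\mathsf{in},\mathsf{states},\mathsf{out}$ and is freely generated by arrows $\triangleright\colon\mathsf{in}\to\mathsf{states}$, $a\colon\mathsf{states}\to\mathsf{states}$ ($a\in A$), $\triangleleft\colon\mathsf{states}\to\mathsf{out}$; composition is written left to right as concatenation, so the arrows $\mathsf{in}\to\mathsf{out}$ are the $\triangleright w\triangleleft$ with $w\in A^*$. $\mathcal{O}_{\mathsf{word}}$ is the full subcategory on $\mathsf{in},\mathsf{out}$, with inclusion $\iota$. $\mathcal{T}$ is the monad $\mathcal{T}X=B^*\times X+1$ on $\mathsf{Set}$ (with $\bot$ the element of the summand $1$), unit $x\mapsto(\varepsilon,x)$ and multiplication $(w,(u,x))\mapsto(wu,x)$, $(w,\bot)\mapsto\bot$, $\bot\mapsto\bot$. $\mathsf{Kl}(\mathcal{T})$ is its Kleisli category; a morphism $f\colon X\nrightarrow Y$ is a function $X\to B^*\times Y+1$. Let $1=\{0\}$; $\mathcal{T}1$ is identified with $B^*+1$. The language $\mathcal{L}_{\mathsf{Kl}(\mathcal{T})}$ sends $\mathsf{in},\mathsf{out}$ to $1$ and $\triangleright w\triangleleft$ to $L(w)\colon1\nrightarrow1$ (with $L(w)=\bot$ if undefined). $\mathsf{Auto}(\mathcal{L})$ is the category of functors $\mathcal{A}\colon\mathcal{I}_{\mathsf{word}}\to\mathsf{Kl}(\mathcal{T})$ with $\mathcal{A}\circ\iota=\mathcal{L}$, with arrows the natural transformations $\alpha$ with $\alpha\circ\iota=\mathrm{id}_{\mathcal{L}}$.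 $\kappa_\bot\in(B^*+1)^{A^*}$ is the constant function with value $\bot$. For $K\neq\kappa_\bot$ in $(B^*+1)^{A^*}$: $\mathsf{lcp}(K)\in B^*$ is the longest word that is a prefix of all $K(u)\neq\bot$, $u\in A^*$; $\mathsf{red}(K)\in(B^*+1)^{A^*}$ is defined by $\mathsf{red}(K)(u)=v$ if $K(u)=\mathsf{lcp}(K)\,v$ and $\mathsf{red}(K)(u)=\bot$ otherwise; $K$ is irreducible if $\mathsf{lcp}(K)=\varepsilon$. $\mathsf{Irr}(A^*,B^*)$ is the set of irreducible functions (in particular $\kappa_\bot\notin\mathsf{Irr}(A^*,B^*)$). For $a\in A$, $a^{ -1}K$ is the function $w\mapsto K(aw)$. -}

module Defs where

open import Level using (Level; _⊔_; suc)
open import Axiom.ExcludedMiddle using (ExcludedMiddle)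
open import Axiom.Extensionality.Propositional using (Extensionality)
open import Data.Empty using (⊥-elim)
open import Data.List.Base using (List; []; _∷_; _++_; length)
open import Data.List.Properties using (++-assoc; ++-identityʳ; length-++)
open import Data.List.Relation.Binary.Pointwise as Pointwise using (Pointwise-≡⇒≡)
open import Data.List.Relation.Binary.Prefix.Heterogeneous as Prefix using (Prefix; []; toView)
import Data.List.Relation.Binary.Prefix.Heterogeneous.Properties as Prefix
open import Data.Maybe.Base as Maybe using (Maybe; just; nothing)
open import Data.Maybe.Properties using (just-injective)
open import Data.Nat.Base as ℕ using (ℕ; _≤_; z≤n; s≤s)
open import Data.Nat.Properties using (≤∧≢⇒<; ≤-reflexive; n≤0⇒n≡0; +-cancelˡ-≤; +-identityʳ)
open import Data.Product.Base as Product using (∃; ∃-syntax; _×_; _,_; proj₁; proj₂)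
open import Data.Unit.Polymorphic.Base using (⊤; tt)
open import Function.Base using (_∘_; _on_)
open import Relation.Binary.Bundles using (Setoid)
open import Relation.Binary.Core using (Rel)
open import Relation.Binary.Structures using (IsEquivalence)
open import Relation.Binary.Construct.Closure.ReflexiveTransitive using (Star; ε; _◅_; _◅◅_; gfold)
open import Relation.Binary.Construct.Closure.ReflexiveTransitive.Properties using (◅◅-assoc)
open import Relation.Binary.PropositionalEquality
  using (_≡_; _≢_; refl; sym; trans; cong; cong₂; subst₂; _≗_; isEquivalence)
import Relation.Binary.Reasoning.Setoid as SetoidReasoning
open import Relation.Nullary using (yes; no)

private variable
  o ℓ e o′ ℓ′ e′ o″ ℓ″ e″ : Level

------------------------------------------------------------------------
-- Categories

-- Composition is in diagrammatic order: f ⨾ g is "first f, then g".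

record Category (o ℓ e : Level) : Set (suc (o ⊔ ℓ ⊔ e)) where
  infix  4 _≈_
  infixl 7 _⨾_
  field
    Obj           : Set o
    Hom           : Obj → Obj → Set ℓ
    _≈_           : ∀ {X Y} → Rel (Hom X Y) e
    id            : ∀ {X} → Hom X X
    _⨾_           : ∀ {X Y Z} → Hom X Y → Hom Y Z → Hom X Z
    ≈-equivalence : ∀ {X Y} → IsEquivalence (_≈_ {X} {Y})
    ⨾-cong        : ∀ {X Y Z} {f f′ : Hom X Y} {g g′ : Hom Y Z} →
                    f ≈ f′ → g ≈ g′ → f ⨾ g ≈ f′ ⨾ g′
    identityˡ     : ∀ {X Y} (f : Hom X Y) → id ⨾ f ≈ f
    identityʳ     : ∀ {X Y} (f : Hom X Y) → f ⨾ id ≈ f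
    assoc         : ∀ {W X Y Z} (f : Hom W X) (g : Hom X Y) (h : Hom Y Z) →
                    (f ⨾ g) ⨾ h ≈ f ⨾ (g ⨾ h)

  hom-setoid : Obj → Obj → Setoid ℓ e
  hom-setoid X Y = record { Carrier = Hom X Y ; _≈_ = _≈_ ; isEquivalence = ≈-equivalence }

  module _ {X Y : Obj} where
    open IsEquivalence (≈-equivalence {X} {Y}) public
      renaming (refl to ≈-refl; sym to ≈-sym; trans to ≈-trans; reflexive to ≈-reflexive)

record Functor (C : Category o ℓ e) (D : Category o′ ℓ′ e′) :
               Set (o ⊔ ℓ ⊔ e ⊔ o′ ⊔ ℓ′ ⊔ e′) where
  private
    module C = Category C
    module D = Category D
  field
    F₀           : C.Obj → D.Obj
    F₁           : ∀ {X Y} → C.Hom X Y → D.Hom (F₀ X) (F₀ Y)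
    F-cong       : ∀ {X Y} {f g : C.Hom X Y} → f C.≈ g → F₁ f D.≈ F₁ g
    identity     : ∀ {X} → F₁ (C.id {X}) D.≈ D.id
    homomorphism : ∀ {X Y Z} (f : C.Hom X Y) (g : C.Hom Y Z) → F₁ (f C.⨾ g) D.≈ F₁ f D.⨾ F₁ g

-- Diagrammatic order again: F ∘F G in the usual notation is G ⨾F F here.

infixl 7 _⨾F_

_⨾F_ : {C : Category o ℓ e} {D : Category o′ ℓ′ e′} {E : Category o″ ℓ″ e″} →
       Functor C D → Functor D E → Functor C E
_⨾F_ {E = E} F G = record
  { F₀           = G.F₀ ∘ F.F₀
  ; F₁           = G.F₁ ∘ F.F₁
  ; F-cong       = G.F-cong ∘ F.F-cong
  ; identity     = E.≈-trans (G.F-cong F.identity) G.identity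
  ; homomorphism = λ f g → E.≈-trans (G.F-cong (F.homomorphism f g)) (G.homomorphism _ _)
  }
  where
  module E = Category E
  module F = Functor F
  module G = Functor G

-- Strict equality of functors: equal on objects, and, after transport
-- along the equalities of objects, equal on morphisms.

record _≡F_ {C : Category o ℓ e} {D : Category o′ ℓ′ e′} (F G : Functor C D) :
            Set (o ⊔ ℓ ⊔ e ⊔ o′ ⊔ ℓ′ ⊔ e′) where
  private
    module C = Category C
    module D = Category D
    module F = Functor F
    module G = Functor G
  field
    eq₀ : ∀ X → F.F₀ X ≡ G.F₀ X
    eq₁ : ∀ {X Y} (f : C.Hom X Y) → subst₂ D.Hom (eq₀ X) (eq₀ Y) (F.F₁ f) D.≈ G.F₁ f

record NaturalTransformation {C : Category o ℓ e} {D : Category o′ ℓ′ e′}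
                             (F G : Functor C D) : Set (o ⊔ ℓ ⊔ e ⊔ o′ ⊔ ℓ′ ⊔ e′) where
  private
    module C = Category C
    module D = Category D
    module F = Functor F
    module G = Functor G
  field
    η       : ∀ X → D.Hom (F.F₀ X) (G.F₀ X)
    natural : ∀ {X Y} (f : C.Hom X Y) → η X D.⨾ G.F₁ f D.≈ F.F₁ f D.⨾ η Y

module _ {C : Category o ℓ e} {D : Category o′ ℓ′ e′} where
  private
    module D = Category D
  open NaturalTransformation

  idNT : (F : Functor C D) → NaturalTransformation F F
  idNT F .η X       = D.id
  idNT F .natural f = D.≈-trans (D.identityˡ _) (D.≈-sym (D.identityʳ _))

  _⨾NT_ : {F G H : Functor C D} →
          NaturalTransformation F G → NaturalTransformation G H → NaturalTransformation F H
  (α ⨾NT β) .η X = α .η X D.⨾ β .η X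
  _⨾NT_ {F} {G} {H} α β .natural {X} {Y} f = begin
    (α .η X D.⨾ β .η X) D.⨾ H.F₁ f  ≈⟨ D.assoc _ _ _ ⟩
    α .η X D.⨾ (β .η X D.⨾ H.F₁ f)  ≈⟨ D.⨾-cong D.≈-refl (β .natural f) ⟩
    α .η X D.⨾ (G.F₁ f D.⨾ β .η Y)  ≈⟨ D.assoc _ _ _ ⟨
    (α .η X D.⨾ G.F₁ f) D.⨾ β .η Y  ≈⟨ D.⨾-cong (α .natural f) D.≈-refl ⟩
    (F.F₁ f D.⨾ α .η Y) D.⨾ β .η Y  ≈⟨ D.assoc _ _ _ ⟩
    F.F₁ f D.⨾ (α .η Y D.⨾ β .η Y)  ∎
    where
    module F = Functor F
    module G = Functor G
    module H = Functor H
    open SetoidReasoning (D.hom-setoid (F.F₀ X) (H.F₀ Y))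

record IsTerminal (C : Category o ℓ e) (T : Category.Obj C) : Set (o ⊔ ℓ ⊔ e) where
  open Category C
  field
    !        : ∀ X → Hom X T
    !-unique : ∀ {X} (f : Hom X T) → f ≈ ! X

FullSubcategory : (C : Category o ℓ e) {I : Set o′} → (I → Category.Obj C) → Category o′ ℓ e
FullSubcategory C {I} U = record
  { Obj           = I
  ; Hom           = Hom on U
  ; _≈_           = _≈_
  ; id            = id
  ; _⨾_           = _⨾_
  ; ≈-equivalence = ≈-equivalence
  ; ⨾-cong        = ⨾-cong
  ; identityˡ     = identityˡ
  ; identityʳ     = identityʳ
  ; assoc         = assoc
  }
  where open Category C

inclusion : (C : Category o ℓ e) {I : Set o′} (U : I → Category.Obj C) →
            Functor (FullSubcategory C U) C
inclusion C U = record
  { F₀           = U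
  ; F₁           = λ f → f
  ; F-cong       = λ p → p
  ; identity     = ≈-refl
  ; homomorphism = λ _ _ → ≈-refl
  }
  where open Category C

Free : {I : Set o} → Rel I ℓ → Category o (o ⊔ ℓ) (o ⊔ ℓ)
Free {I = I} G = record
  { Obj           = I
  ; Hom           = Star G
  ; _≈_           = _≡_
  ; id            = ε
  ; _⨾_           = _◅◅_
  ; ≈-equivalence = isEquivalence
  ; ⨾-cong        = cong₂ _◅◅_
  ; identityˡ     = λ _ → refl
  ; identityʳ     = ◅◅-ε
  ; assoc         = ◅◅-assoc
  }
  where
  ◅◅-ε : ∀ {i j} (p : Star G i j) → p ◅◅ ε ≡ p
  ◅◅-ε ε       = refl
  ◅◅-ε (x ◅ p) = cong (x ◅_) (◅◅-ε p)

-- The functor out of a free category determined by its values on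
-- objects and generating arrows.

extend : {I : Set o} {G : Rel I ℓ} (C : Category o′ ℓ′ e′) →
         let module C = Category C in
         (F₀ : I → C.Obj) → (∀ {i j} → G i j → C.Hom (F₀ i) (F₀ j)) →
         Functor (Free G) C
extend {G = G} C F₀ F₁ = record
  { F₀           = F₀
  ; F₁           = ⟦_⟧
  ; F-cong       = λ { refl → ≈-refl }
  ; identity     = ≈-refl
  ; homomorphism = hom
  }
  where
  open Category C

  ⟦_⟧ : ∀ {i j} → Star G i j → Hom (F₀ i) (F₀ j)
  ⟦_⟧ = gfold F₀ Hom (λ g f → F₁ g ⨾ f) id

  hom : ∀ {i j k} (p : Star G i j) (q : Star G j k) → ⟦ p ◅◅ q ⟧ ≈ ⟦ p ⟧ ⨾ ⟦ q ⟧
  hom ε       q = ≈-sym (identityˡ _)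
  hom (x ◅ p) q = ≈-trans (⨾-cong ≈-refl (hom p q)) (≈-sym (assoc _ _ _))

------------------------------------------------------------------------
-- The category of automata accepting a language

module _ {𝓘 : Category o ℓ e} {𝓞 : Category o′ ℓ e} {𝓒 : Category o″ ℓ″ e″}
         (ι : Functor 𝓞 𝓘) (𝓛 : Functor 𝓞 𝓒) where
  private
    module 𝓘 = Category 𝓘
    module 𝓞 = Category 𝓞
    module 𝓒 = Category 𝓒
    module ι = Functor ι
    module 𝓛 = Functor 𝓛

  record Automaton : Set (o ⊔ ℓ ⊔ e ⊔ o′ ⊔ o″ ⊔ ℓ″ ⊔ e″) where
    constructor automaton
    field
      functor : Functor 𝓘 𝓒
      accepts : (ι ⨾F functor) ≡F 𝓛
    open Functor functor public
    open _≡F_ accepts public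

  -- The condition α ∘ ι = id compares arrows 𝒜 (ι X) → ℬ (ι X) with
  -- arrows 𝓛 X → 𝓛 X, hence the transport.

  record AutomatonMorphism (𝒜 ℬ : Automaton) : Set (o ⊔ ℓ ⊔ e ⊔ o′ ⊔ o″ ⊔ ℓ″ ⊔ e″) where
    private
      module 𝒜 = Automaton 𝒜
      module ℬ = Automaton ℬ
    field
      transformation : NaturalTransformation 𝒜.functor ℬ.functor
    open NaturalTransformation transformation public
    field
      restrict : ∀ X → subst₂ 𝓒.Hom (𝒜.eq₀ X) (ℬ.eq₀ X) (η (ι.F₀ X)) 𝓒.≈ 𝓒.id {𝓛.F₀ X}

  private
    transport-id : ∀ {X Y} (p : X ≡ Y) → subst₂ 𝓒.Hom p p 𝓒.id ≡ 𝓒.id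
    transport-id refl = refl

    transport-⨾ : ∀ {X X′ Y Y′ Z Z′} (p : X ≡ X′) (q : Y ≡ Y′) (r : Z ≡ Z′)
                  (f : 𝓒.Hom X Y) (g : 𝓒.Hom Y Z) →
                  subst₂ 𝓒.Hom p r (f 𝓒.⨾ g) ≡ subst₂ 𝓒.Hom p q f 𝓒.⨾ subst₂ 𝓒.Hom q r g
    transport-⨾ refl refl refl f g = refl

  Auto : Category (o ⊔ ℓ ⊔ e ⊔ o′ ⊔ o″ ⊔ ℓ″ ⊔ e″) (o ⊔ ℓ ⊔ e ⊔ o′ ⊔ o″ ⊔ ℓ″ ⊔ e″) (o ⊔ e″)
  Auto = record
    { Obj           = Automaton
    ; Hom           = AutomatonMorphism
    ; _≈_           = λ α β → ∀ X → α .η X 𝓒.≈ β .η X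
    ; id            = λ {𝒜} → record
        { transformation = idNT (𝒜 .Automaton.functor)
        ; restrict       = λ X → 𝓒.≈-reflexive (transport-id (𝒜 .Automaton.eq₀ X))
        }
    ; _⨾_           = λ {𝒜} {ℬ} {𝒞} α β → record
        { transformation = α .transformation ⨾NT β .transformation
        ; restrict       = λ X →
            𝓒.≈-trans (𝓒.≈-reflexive (transport-⨾ (𝒜 .Automaton.eq₀ X) (ℬ .Automaton.eq₀ X)
                                                   (𝒞 .Automaton.eq₀ X) _ _))
            (𝓒.≈-trans (𝓒.⨾-cong (α .restrict X) (β .restrict X)) (𝓒.identityˡ _))
        }
    ; ≈-equivalence = record
        { refl  = λ _ → 𝓒.≈-refl
        ; sym   = λ p X → 𝓒.≈-sym (p X)
        ; trans = λ p q X → 𝓒.≈-trans (p X) (q X)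
        }
    ; ⨾-cong        = λ p q X → 𝓒.⨾-cong (p X) (q X)
    ; identityˡ     = λ _ _ → 𝓒.identityˡ _
    ; identityʳ     = λ _ _ → 𝓒.identityʳ _
    ; assoc         = λ _ _ _ _ → 𝓒.assoc _ _ _
    }
    where open AutomatonMorphism

------------------------------------------------------------------------
-- The input category

data Object : Set where
  inp states out : Object

data Generator {a} (A : Set a) : Rel Object a where
  ▷      : Generator A inp states
  letter : A → Generator A states states
  ◁      : Generator A states out

data OuterObject : Set where
  inp out : OuterObject

outer : OuterObject → Object
outer inp = inp
outer out = out

module _ {a} (A : Set a) where

  𝓘word : Category _ a a
  𝓘word = Free (Generator A)

  𝓞word : Category _ a a
  𝓞word = FullSubcategory 𝓘word outer

  ιword : Functor 𝓞word 𝓘word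
  ιword = inclusion 𝓘word outer

-- The word w of an arrow w◁ : states → out.

word : ∀ {a} {A : Set a} → Star (Generator A) states out → List A
word (letter a ◅ p) = a ∷ word p
word (◁ ◅ ε)        = []

------------------------------------------------------------------------
-- Kleisli category of 𝒯X = B*×X+1; nothing is the element ⊥ of the
-- summand 1

module _ {b} (B : Set b) where

  𝒯 : Set b → Set b
  𝒯 X = Maybe (List B × X)

module _ {b} {B : Set b} where

  𝒯-map : {X Y : Set b} → (X → Y) → 𝒯 B X → 𝒯 B Y
  𝒯-map f = Maybe.map (Product.map₂ f)

  unit : {X : Set b} → X → 𝒯 B X
  unit x = just ([] , x)

  multiply : {X : Set b} → 𝒯 B (𝒯 B X) → 𝒯 B X
  multiply (just (w , just (u , x))) = just (w ++ u , x)
  multiply (just (w , nothing))      = nothing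
  multiply nothing                   = nothing

module _ {b} (B : Set b) where

  Kl : Category (suc b) b b
  Kl = record
    { Obj           = Set b
    ; Hom           = λ X Y → X → 𝒯 B Y
    ; _≈_           = _≗_
    ; id            = unit
    ; _⨾_           = λ f g → multiply ∘ 𝒯-map g ∘ f
    ; ≈-equivalence = record
        { refl  = λ _ → refl
        ; sym   = λ p x → sym (p x)
        ; trans = λ p q x → trans (p x) (q x)
        }
    ; ⨾-cong        = λ {_} {_} {_} {f} {f′} {g} {g′} → ⨾-cong {f = f} {f′} {g} {g′}
    ; identityˡ     = identityˡ
    ; identityʳ     = identityʳ
    ; assoc         = assoc
    }
    where
    ⨾-cong : {X Y Z : Set b} {f f′ : X → 𝒯 B Y} {g g′ : Y → 𝒯 B Z} → f ≗ f′ → g ≗ g′ →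
             multiply ∘ 𝒯-map g ∘ f ≗ multiply ∘ 𝒯-map g′ ∘ f′
    ⨾-cong {f′ = f′} p q x rewrite p x with f′ x
    ... | nothing      = refl
    ... | just (w , y) rewrite q y = refl

    identityˡ : {X Y : Set b} (f : X → 𝒯 B Y) → multiply ∘ 𝒯-map f ∘ unit ≗ f
    identityˡ f x with f x
    ... | nothing = refl
    ... | just _  = refl

    identityʳ : {X Y : Set b} (f : X → 𝒯 B Y) → multiply ∘ 𝒯-map unit ∘ f ≗ f
    identityʳ f x with f x
    ... | nothing      = refl
    ... | just (w , y) = cong (λ v → just (v , y)) (++-identityʳ w)

    assoc : {W X Y Z : Set b} (f : W → 𝒯 B X) (g : X → 𝒯 B Y) (h : Y → 𝒯 B Z) →
            multiply ∘ 𝒯-map h ∘ multiply ∘ 𝒯-map g ∘ f ≗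
            multiply ∘ 𝒯-map (multiply ∘ 𝒯-map h ∘ g) ∘ f
    assoc f g h x with f x
    ... | nothing      = refl
    ... | just (u , y) with g y
    ...   | nothing      = refl
    ...   | just (v , z) with h z
    ...     | nothing      = refl
    ...     | just (w , t) = cong (λ s → just (s , t)) (++-assoc u v w)

------------------------------------------------------------------------
-- Languages

-- (B*+1)^{A*}, i.e. partial functions A* ⇀ B*.

Fun : ∀ {a b} → Set a → Set b → Set (a ⊔ b)
Fun A B = List A → Maybe (List B)

κ⊥ : ∀ {a b} {A : Set a} {B : Set b} → Fun A B
κ⊥ _ = nothing

-- The identification of B*+1 with 𝒯1.

to𝒯1 : ∀ {b} {B : Set b} → Maybe (List B) → 𝒯 B ⊤
to𝒯1 = Maybe.map (_, tt)

module _ {c} {A B : Set c} where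

  -- The only arrows inp → inp and out → out are identities, and there
  -- is no arrow out → inp.

  language : Fun A B → Functor (𝓞word A) (Kl B)
  language L = record
    { F₀           = λ _ → ⊤
    ; F₁           = λ {X} {Y} → L₁ {X} {Y}
    ; F-cong       = λ { refl _ → refl }
    ; identity     = λ {X} → L-id {X}
    ; homomorphism = λ {X} {Y} {Z} → L-⨾ {X} {Y} {Z}
    }
    where
    open Category (Kl B)

    L₁ : ∀ {X Y} → Star (Generator A) (outer X) (outer Y) → Hom ⊤ ⊤
    L₁ {inp} {out} (▷ ◅ p) = λ _ → to𝒯1 (L (word p))
    L₁ {inp} {inp} _       = id
    L₁ {out} {out} _       = id
    L₁ {out} {inp} (() ◅ _)

    L-id : ∀ {X} → L₁ {X} {X} ε ≈ id
    L-id {inp} _ = refl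
    L-id {out} _ = refl

    states↛inp : {R : Set c} → Star (Generator A) states inp → R
    states↛inp (letter _ ◅ p)  = states↛inp p
    states↛inp (◁ ◅ (() ◅ _))

    L-⨾ : ∀ {X Y Z} (p : Star (Generator A) (outer X) (outer Y))
          (q : Star (Generator A) (outer Y) (outer Z)) →
          L₁ {X} {Z} (p ◅◅ q) ≈ L₁ {X} {Y} p ⨾ L₁ {Y} {Z} q
    L-⨾ {inp} {inp} {Z}   ε       q        = λ x → sym (identityˡ (L₁ {inp} {Z} q) x)
    L-⨾ {inp} {inp} {Z}   (▷ ◅ p) q        = states↛inp p
    L-⨾ {inp} {out} {out} (▷ ◅ p) ε        = λ x →
      trans (cong (λ r → L₁ {inp} {out} (▷ ◅ r) x) (Category.identityʳ (𝓘word A) p))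
            (sym (identityʳ (L₁ {inp} {out} (▷ ◅ p)) x))
    L-⨾ {out} {out} {out} p       q        = λ _ → refl
    L-⨾ {out} {inp} {Z}   (() ◅ _) q
    L-⨾ {X}   {out} {inp} p       (() ◅ _)

------------------------------------------------------------------------
-- Longest common prefixes and reduction

module _ {a b} {A : Set a} {B : Set b} where

  CommonPrefix : Fun A B → List B → Set (a ⊔ b)
  CommonPrefix K w = ∀ u v → K u ≡ just v → Prefix _≡_ w v

  record LongestCommonPrefix (K : Fun A B) (w : List B) : Set (a ⊔ b) where
    field
      common  : CommonPrefix K w
      longest : ∀ w′ → CommonPrefix K w′ → length w′ ≤ length w

  infix 8 _⁻¹_

  _⁻¹_ : A → Fun A B → Fun A B
  (x ⁻¹ K) w = K (x ∷ w)

split : ∀ {b} {B : Set b} {w v : List B} → Prefix _≡_ w v → ∃[ s ] v ≡ w ++ s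
split p with eqs Prefix.++ s ← toView p = s , cong (_++ s) (sym (Pointwise-≡⇒≡ eqs))

-- Excluded middle is needed to decide whether K = κ⊥ and for longest
-- common prefixes to exist; together with function extensionality it
-- makes types behave like the sets of classical mathematics.

module Classical {c} (em : ExcludedMiddle c) (ext : Extensionality c c) {A B : Set c} where

  defined : (K : Fun A B) → K ≢ κ⊥ → ∃[ u ] ∃[ v ] K u ≡ just v
  defined K K≢κ⊥ with em {∃[ u ] ∃[ v ] K u ≡ just v}
  ... | yes d = d
  ... | no ¬d = ⊥-elim (K≢κ⊥ (ext λ u → undefined u (K u) refl))
    where
    undefined : ∀ u x → K u ≡ x → K u ≡ nothing
    undefined u nothing  eq = eq
    undefined u (just v) eq = ⊥-elim (¬d (u , v , eq))

  -- Search downwards from an upper bound on the lengths of common prefixes.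
  search : (K : Fun A B) (n : ℕ) → (∀ w → CommonPrefix K w → length w ≤ n) →
           ∃ (LongestCommonPrefix K)
  search K n bound with em {∃[ w ] CommonPrefix K w × length w ≡ n}
  search K n bound | yes (w , cw , refl) = w , record { common = cw ; longest = bound }
  search K ℕ.zero bound | no ¬w = ⊥-elim (¬w ([] , (λ _ _ _ → []) , refl))
  search K (ℕ.suc n) bound | no ¬w = search K n bound′
    where
    bound′ : ∀ w → CommonPrefix K w → length w ≤ n
    bound′ w cw with s≤s p ← ≤∧≢⇒< (bound w cw) (λ eq → ¬w (w , cw , eq)) = p

  -- Abstract, because only the specification matters.
  abstract
    lcp-exists : (K : Fun A B) → K ≢ κ⊥ → ∃ (LongestCommonPrefix K)
    lcp-exists K K≢κ⊥ with u , v , eq ← defined K K≢κ⊥ =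
      search K (length v) λ w cw → Prefix.length-mono (cw u v eq)

  lcp : (K : Fun A B) → K ≢ κ⊥ → List B
  lcp K K≢κ⊥ = proj₁ (lcp-exists K K≢κ⊥)

  lcp-spec : (K : Fun A B) (K≢κ⊥ : K ≢ κ⊥) → LongestCommonPrefix K (lcp K K≢κ⊥)
  lcp-spec K K≢κ⊥ = proj₂ (lcp-exists K K≢κ⊥)

  red : (K : Fun A B) → K ≢ κ⊥ → Fun A B
  red K K≢κ⊥ u with em {∃[ v ] K u ≡ just (lcp K K≢κ⊥ ++ v)}
  ... | yes (v , _) = just v
  ... | no _        = nothing

  record Irr : Set c where
    field
      fun         : Fun A B
      fun≢κ⊥      : fun ≢ κ⊥
      irreducible : lcp fun fun≢κ⊥ ≡ []

  red-defined : (K : Fun A B) (K≢κ⊥ : K ≢ κ⊥) → ∀ u v → K u ≡ just v →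
                ∃[ s ] v ≡ lcp K K≢κ⊥ ++ s × red K K≢κ⊥ u ≡ just s
  red-defined K K≢κ⊥ u v eq with em {∃[ s ] K u ≡ just (lcp K K≢κ⊥ ++ s)}
  ... | yes (s , eq′) = s , just-injective (trans (sym eq) eq′) , refl
  ... | no ¬s with s , refl ← split (LongestCommonPrefix.common (lcp-spec K K≢κ⊥) u v eq) =
    ⊥-elim (¬s (s , eq))

  red≢κ⊥ : (K : Fun A B) (K≢κ⊥ : K ≢ κ⊥) → red K K≢κ⊥ ≢ κ⊥
  red≢κ⊥ K K≢κ⊥ red≡κ⊥
    with u , v , eq ← defined K K≢κ⊥
    with s , _ , eq′ ← red-defined K K≢κ⊥ u v eq
    with () ← trans (sym eq′) (cong (λ f → f u) red≡κ⊥)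

  red-irreducible : (K : Fun A B) (K≢κ⊥ : K ≢ κ⊥) → lcp (red K K≢κ⊥) (red≢κ⊥ K K≢κ⊥) ≡ []
  red-irreducible K K≢κ⊥ = empty q (n≤0⇒n≡0 (+-cancelˡ-≤ (length p) _ _ bound))
    where
    p q : List B
    p = lcp K K≢κ⊥
    q = lcp (red K K≢κ⊥) (red≢κ⊥ K K≢κ⊥)

    common : CommonPrefix K (p ++ q)
    common u v eq with s , refl , eq′ ← red-defined K K≢κ⊥ u v eq =
      Prefix.++⁺ (Pointwise.refl refl)
        (LongestCommonPrefix.common (lcp-spec (red K K≢κ⊥) (red≢κ⊥ K K≢κ⊥)) u s eq′)

    bound : length p ℕ.+ length q ≤ length p ℕ.+ 0
    bound = subst₂ _≤_ (length-++ p) (sym (+-identityʳ (length p)))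
              (LongestCommonPrefix.longest (lcp-spec K K≢κ⊥) (p ++ q) common)

    empty : (w : List B) → length w ≡ 0 → w ≡ []
    empty [] _ = refl

  redIrr : (K : Fun A B) → K ≢ κ⊥ → Irr
  redIrr K K≢κ⊥ = record
    { fun         = red K K≢κ⊥
    ; fun≢κ⊥      = red≢κ⊥ K K≢κ⊥
    ; irreducible = red-irreducible K K≢κ⊥
    }

  factor : Fun A B → 𝒯 B Irr
  factor K with em {K ≡ κ⊥}
  ... | yes _   = nothing
  ... | no K≢κ⊥ = just (lcp K K≢κ⊥ , redIrr K K≢κ⊥)

  𝒜final : Fun A B → Functor (𝓘word A) (Kl B)
  𝒜final L = extend (Kl B) 𝒜₀ 𝒜₁
    where
    𝒜₀ : Object → Set c
    𝒜₀ inp    = ⊤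
    𝒜₀ states = Irr
    𝒜₀ out    = ⊤

    𝒜₁ : ∀ {X Y} → Generator A X Y → 𝒜₀ X → 𝒯 B (𝒜₀ Y)
    𝒜₁ ▷          _ = factor L
    𝒜₁ (letter x) K = factor (x ⁻¹ Irr.fun K)
    𝒜₁ ◁          K = to𝒯1 (Irr.fun K [])

{-# OPTIONS --safe #-}
module Submission where

-- An element t of 𝒯 Irr represents the function ⟨ t ⟩, and this
-- representation is a bijection with inverse factor: a nonempty partial
-- function factors uniquely as a word followed by an irreducible function.
-- Since the arrow w◁ of the final automaton sends K to K w, the arrows
-- states → out are jointly monic.  Naturality and uniqueness at states
-- therefore only have to be checked after composition with arrows into out,
-- where they follow from the condition that automata restrict to the language.

open import Defs
open import Axiom.ExcludedMiddle using (ExcludedMiddle)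
open import Axiom.Extensionality.Propositional using (Extensionality)
open import Axiom.UniquenessOfIdentityProofs.WithK using (uip)
open import Data.Empty using (⊥; ⊥-elim)
open import Data.List.Base using (List; []; _∷_; _++_; length)
open import Data.List.Properties using (++-assoc; ++-identityʳ; ++-cancelˡ; ∷-injective)
import Data.List.Relation.Binary.Pointwise as Pointwise
import Data.List.Relation.Binary.Prefix.Heterogeneous as Prefix
open import Data.Maybe.Base as Maybe using (Maybe; just; nothing)
open import Data.Maybe.Properties using (just-injective; map-injective)
open import Data.Nat.Base using (_≤_)
open import Data.Product.Base using (Σ-syntax; ∃-syntax; _,_; proj₁)
open import Data.Sum.Base using (_⊎_; inj₁; inj₂)
open import Data.Unit.Polymorphic.Base using (⊤; tt)
open import Function.Base using (_∘_)
open import Relation.Binary.Construct.Closure.ReflexiveTransitive using (Star; ε; _◅_; _◅◅_)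
open import Relation.Binary.PropositionalEquality
  using (_≡_; refl; sym; trans; cong; subst; subst₂; _≗_; module ≡-Reasoning)
import Relation.Binary.Reasoning.Setoid as SetoidReasoning
open import Relation.Nullary using (yes; no)

++-comparable : ∀ {b} {B : Set b} (u u′ : List B) {v v′ : List B} → u ++ v ≡ u′ ++ v′ →
                (∃[ s ] u′ ≡ u ++ s) ⊎ (∃[ s ] u ≡ u′ ++ s)
++-comparable []      u′       eq = inj₁ (u′ , refl)
++-comparable (x ∷ u) []       eq = inj₂ (x ∷ u , refl)
++-comparable (x ∷ u) (y ∷ u′) eq with refl , eq′ ← ∷-injective eq with ++-comparable u u′ eq′
... | inj₁ (s , refl) = inj₁ (s , refl)
... | inj₂ (s , refl) = inj₂ (s , refl)

module _ {a} {A : Set a} where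

  path : List A → Star (Generator A) states out
  path []      = ◁ ◅ ε
  path (a ∷ w) = letter a ◅ path w

  word-path : ∀ w → word (path w) ≡ w
  word-path []      = refl
  word-path (a ∷ w) = cong (a ∷_) (word-path w)

  path-word : ∀ p → path (word p) ≡ p
  path-word (letter a ◅ p) = cong (letter a ◅_) (path-word p)
  path-word (◁ ◅ ε)        = refl

  states↛inp : Star (Generator A) states inp → ⊥
  states↛inp (letter _ ◅ p)  = states↛inp p
  states↛inp (◁ ◅ (() ◅ _))

module _ {b} {B : Set b} where

  from𝒯1 : 𝒯 B (⊤ {b}) → Maybe (List B)
  from𝒯1 = Maybe.map proj₁

  to𝒯1∘from𝒯1 : ∀ t → to𝒯1 (from𝒯1 t) ≡ t
  to𝒯1∘from𝒯1 nothing  = refl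
  to𝒯1∘from𝒯1 (just _) = refl

  to𝒯1-injective : ∀ {x y} → to𝒯1 {B = B} x ≡ to𝒯1 y → x ≡ y
  to𝒯1-injective = map-injective (cong proj₁)

  multiply-to𝒯1 : ∀ u x → multiply (just (u , to𝒯1 x)) ≡ to𝒯1 {B = B} (Maybe.map (u ++_) x)
  multiply-to𝒯1 u nothing  = refl
  multiply-to𝒯1 u (just v) = refl

  open Category (Kl B)

  -- An automaton takes `inp` and `out` to sets that only propositionally equal `⊤`. Turning such an
  -- equality into a Kleisli arrow lets composition replace transport.
  cast : {X Y : Set b} → X ≡ Y → Hom X Y
  cast refl = unit

  transport-square : {X X′ Y Y′ : Set b} (p : X ≡ X′) (q : Y ≡ Y′) (f : Hom X Y) (g : Hom X′ Y′) →
                     subst₂ Hom p q f ≈ g → cast p ⨾ g ≈ f ⨾ cast q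
  transport-square refl refl f g eq x =
    trans (identityˡ g x) (trans (sym (eq x)) (sym (identityʳ f x)))

  transport-cast : {X Y : Set b} (p : X ≡ Y) → subst₂ Hom p refl (cast p) ≈ id
  transport-cast refl _ = refl

  transport≈id⇒≈cast : {X Y : Set b} (p : X ≡ Y) (f : Hom X Y) →
                       subst₂ Hom p refl f ≈ id → f ≈ cast p
  transport≈id⇒≈cast refl f eq = eq

module _ {c} (em : ExcludedMiddle c) (ext : Extensionality c c) {A B : Set c} where
  open Classical em ext {A} {B}
  open Irr

  -- The negations `fun≢κ⊥` agree definitionally because `⊥` is proof-irrelevant, so `p` and `q`
  -- share a type and `uip` applies.
  Irr-≡ : {I J : Irr} → fun I ≡ fun J → I ≡ J
  Irr-≡ {record { irreducible = p }} {record { irreducible = q }} refl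
    with refl ← uip p q = refl

  ⟨_⟩ : 𝒯 B Irr → Fun A B
  ⟨ nothing ⟩      w = nothing
  ⟨ just (u , I) ⟩ w = Maybe.map (u ++_) (fun I w)

  -- `red` yields `nothing` where `K` has no value extending the lcp. As the lcp is a common prefix,
  -- this happens only where `K` is undefined, so prepending it to `red` restores `K`.
  ⟨⟩-factor : ∀ K w → ⟨ factor K ⟩ w ≡ K w
  ⟨⟩-factor K w with em {K ≡ κ⊥}
  ... | yes refl = refl
  ... | no K≢κ⊥ with em {∃[ v ] K w ≡ just (lcp K K≢κ⊥ ++ v)}
  ...   | yes (v , eq) = sym eq
  ...   | no ¬v with K w in eq
  ...     | nothing = refl
  ...     | just v with s , refl ← split (LongestCommonPrefix.common (lcp-spec K K≢κ⊥) w v eq) =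
    ⊥-elim (¬v (s , refl))

  -- Cancelling `u` makes `s` a common prefix of `fun I`, whose longest common prefix is empty.
  irreducible-shift : ∀ u s I J → ⟨ just (u , I) ⟩ ≗ ⟨ just (u ++ s , J) ⟩ → s ≡ []
  irreducible-shift u s I J eq = empty s (subst (λ w → length s ≤ length w) (irreducible I)
    (LongestCommonPrefix.longest (lcp-spec (fun I) (fun≢κ⊥ I)) s common))
    where
    empty : (w : List B) → length w ≤ 0 → w ≡ []
    empty [] _ = refl

    common : CommonPrefix (fun I) s
    common w v Iw≡v
      -- If `fun J w` were `nothing`, `eq′` would equate a `just` with `nothing`.
      with just v′ ← fun J w | eq′ ← trans (cong (Maybe.map (u ++_)) (sym Iw≡v)) (eq w)
      with refl ← ++-cancelˡ u v (s ++ v′) (trans (just-injective eq′) (++-assoc u s v′))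
      = Prefix.fromView (Pointwise.refl refl Prefix.++ v′)

  -- Irreducible functions are nonempty by definition, so only `nothing` represents `κ⊥`.
  ⟨just⟩≢κ⊥ : ∀ u I → ⟨ just (u , I) ⟩ ≗ κ⊥ → ⊥
  ⟨just⟩≢κ⊥ u I eq with w , v , Iw≡v ← defined (fun I) (fun≢κ⊥ I)
    with () ← trans (sym (cong (Maybe.map (u ++_)) Iw≡v)) (eq w)

  ⟨⟩-injective-fun : ∀ u I J → ⟨ just (u , I) ⟩ ≗ ⟨ just (u , J) ⟩ → I ≡ J
  ⟨⟩-injective-fun u I J eq = Irr-≡ (ext λ w → map-injective (++-cancelˡ u _ _) (eq w))

  ⟨⟩-injective : ∀ t t′ → ⟨ t ⟩ ≗ ⟨ t′ ⟩ → t ≡ t′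
  ⟨⟩-injective nothing        nothing        eq = refl
  ⟨⟩-injective nothing        (just (u , J)) eq = ⊥-elim (⟨just⟩≢κ⊥ u J (λ w → sym (eq w)))
  ⟨⟩-injective (just (u , I)) nothing        eq = ⊥-elim (⟨just⟩≢κ⊥ u I eq)
  ⟨⟩-injective (just (u , I)) (just (u′ , J)) eq
    -- At an argument where `fun I` is defined, `u` and `u′` are prefixes of the same value. Hence
    -- one extends the other, and irreducibility makes the extension empty.
    with w , v , Iw≡v ← defined (fun I) (fun≢κ⊥ I)
    with just v′ ← fun J w | eq′ ← trans (cong (Maybe.map (u ++_)) (sym Iw≡v)) (eq w)
    with ++-comparable u u′ (just-injective eq′)
  ... | inj₁ (s , refl) with refl ← irreducible-shift u s I J eq
    rewrite ++-identityʳ u = cong (λ K → just (u , K)) (⟨⟩-injective-fun u I J eq)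
  ... | inj₂ (s , refl) with refl ← irreducible-shift u′ s J I (λ w → sym (eq w))
    rewrite ++-identityʳ u′ = cong (λ K → just (u′ , K)) (⟨⟩-injective-fun u′ I J eq)

  module _ (L : Fun A B) where
    open Category (Kl B)
    open Functor (𝒜final L) using () renaming (F₁ to run)

    mutual
      -- Reading a letter factors the derivative, and `⟨⟩-factor` undoes this when the rest of the
      -- path is run. The mutual induction descends on the path: `run-⟨⟩` calls `run-state` on the
      -- same path, which calls back on a shorter one.
      run-state : ∀ p K → run p K ≡ to𝒯1 (fun K (word p))
      run-state (letter a ◅ p) K =
        trans (run-⟨⟩ p (factor (a ⁻¹ fun K)))
              (cong to𝒯1 (⟨⟩-factor (a ⁻¹ fun K) (word p)))
      run-state (◁ ◅ ε) K with fun K []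
      ... | nothing = refl
      -- The trailing `ε` is the Kleisli unit and appends `[]` to the output.
      ... | just v  = cong (λ w → just (w , tt)) (++-identityʳ v)

      run-⟨⟩ : ∀ p t → multiply (𝒯-map (run p) t) ≡ to𝒯1 (⟨ t ⟩ (word p))
      run-⟨⟩ p nothing        = refl
      run-⟨⟩ p (just (u , K)) rewrite run-state p K = multiply-to𝒯1 u (fun K (word p))

    -- Composing with `run (path w)` reads off the value of the represented function at `w`.
    states→out-jointly-monic : {X : Set c} {f g : Hom X Irr} →
      (∀ (p : Star (Generator A) states out) → f ⨾ run p ≈ g ⨾ run p) → f ≈ g
    states→out-jointly-monic {f = f} {g} eq x = ⟨⟩-injective (f x) (g x) λ w →
      subst (λ v → ⟨ f x ⟩ v ≡ ⟨ g x ⟩ v) (word-path w)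
        (to𝒯1-injective (trans (sym (run-⟨⟩ (path w) (f x)))
                               (trans (eq (path w) x) (run-⟨⟩ (path w) (g x)))))

    final-accepts : (ιword A ⨾F 𝒜final L) ≡F language L
    final-accepts = record { eq₀ = eq₀ ; eq₁ = λ {X} {Y} → eq₁ X Y }
      where
      eq₀ : ∀ X → Functor.F₀ (𝒜final L) (outer X) ≡ ⊤
      eq₀ inp = refl
      eq₀ out = refl

      eq₁ : ∀ X Y (p : Star (Generator A) (outer X) (outer Y)) →
            subst₂ Hom (eq₀ X) (eq₀ Y) (run p) ≈ Functor.F₁ (language L) {X} {Y} p
      eq₁ inp inp ε        _ = refl
      eq₁ inp inp (▷ ◅ p)  _ = ⊥-elim (states↛inp p)
      eq₁ inp out (▷ ◅ p)  _ = trans (run-⟨⟩ p (factor L)) (cong to𝒯1 (⟨⟩-factor L (word p)))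
      eq₁ out inp (() ◅ _)
      eq₁ out out ε        _ = refl

    final : Automaton (ιword A) (language L)
    final = automaton (𝒜final L) final-accepts

    module _ (𝒜 : Automaton (ιword A) (language L)) where
      private module 𝒜 = Automaton 𝒜

      -- The partial function that `𝒜` computes when started in state `x`.
      stateFun : 𝒜.F₀ states → Fun A B
      stateFun x w = from𝒯1 ((𝒜.F₁ (path w) ⨾ cast (𝒜.eq₀ out)) x)

      -- The outer components are forced by the restriction condition; the middle one sends a state
      -- to the representation of its behaviour.
      final-η : ∀ X → Hom (𝒜.F₀ X) (Functor.F₀ (𝒜final L) X)
      final-η inp    = cast (𝒜.eq₀ inp)
      final-η states = factor ∘ stateFun
      final-η out    = cast (𝒜.eq₀ out)

      Natural : ∀ {X Y} → Star (Generator A) X Y → Set c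
      Natural {X} {Y} p = final-η X ⨾ run p ≈ 𝒜.F₁ p ⨾ final-η Y

      natural-states→out : (p : Star (Generator A) states out) → Natural p
      natural-states→out p x = begin
        (final-η states ⨾ run p) x             ≡⟨ run-⟨⟩ p (factor (stateFun x)) ⟩
        to𝒯1 (⟨ factor (stateFun x) ⟩ (word p)) ≡⟨ cong to𝒯1 (⟨⟩-factor (stateFun x) (word p)) ⟩
        to𝒯1 (stateFun x (word p))             ≡⟨ to𝒯1∘from𝒯1 _ ⟩
        (𝒜.F₁ (path (word p)) ⨾ final-η out) x ≡⟨ cong (λ q → (𝒜.F₁ q ⨾ final-η out) x) (path-word p) ⟩
        (𝒜.F₁ p ⨾ final-η out) x               ∎
        where open ≡-Reasoning

      -- Both automata give the language on `p`; `transport-square` turns acceptance by `𝒜` into the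
      -- required square.
      natural-inp→out : (p : Star (Generator A) inp out) → Natural p
      natural-inp→out p x =
        trans (⨾-cong {f = cast (𝒜.eq₀ inp)} (λ _ → refl) (final-accepts ._≡F_.eq₁ {inp} {out} p) x)
              (transport-square (𝒜.eq₀ inp) (𝒜.eq₀ out) (𝒜.F₁ p) _ (𝒜.eq₁ {inp} {out} p) x)

      natural-ε : ∀ {X} → Natural (ε {x = X})
      natural-ε {X} = begin
        final-η X ⨾ id         ≈⟨ identityʳ (final-η X) ⟩
        final-η X              ≈⟨ identityˡ (final-η X) ⟨
        id ⨾ final-η X         ≈⟨ ⨾-cong {f = id} {𝒜.F₁ ε} {final-η X} (λ x → sym (𝒜.identity x)) (λ _ → refl) ⟩
        𝒜.F₁ ε ⨾ final-η X     ∎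
        where open SetoidReasoning (hom-setoid (𝒜.F₀ X) (Functor.F₀ (𝒜final L) X))

      natural-→out : ∀ {X} (p : Star (Generator A) X out) → Natural p
      natural-→out {inp}    p = natural-inp→out p
      natural-→out {states} p = natural-states→out p
      natural-→out {out}    ε = natural-ε

      -- No induction on `p`: testing against `q` moves the claim to `p ◅◅ q`, an arrow into `out`,
      -- where naturality is known.
      natural-→states : ∀ {X} (p : Star (Generator A) X states) → Natural p
      natural-→states {X} p = states→out-jointly-monic λ q → begin
        (final-η X ⨾ run p) ⨾ run q           ≈⟨ assoc (final-η X) (run p) (run q) ⟩
        final-η X ⨾ (run p ⨾ run q)           ≈⟨ ⨾-cong {f = final-η X} (λ _ → refl) (Functor.homomorphism (𝒜final L) p q) ⟨
        final-η X ⨾ run (p ◅◅ q)              ≈⟨ natural-→out (p ◅◅ q) ⟩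
        𝒜.F₁ (p ◅◅ q) ⨾ final-η out           ≈⟨ ⨾-cong {g = final-η out} (𝒜.homomorphism p q) (λ _ → refl) ⟩
        (𝒜.F₁ p ⨾ 𝒜.F₁ q) ⨾ final-η out       ≈⟨ assoc (𝒜.F₁ p) (𝒜.F₁ q) (final-η out) ⟩
        𝒜.F₁ p ⨾ (𝒜.F₁ q ⨾ final-η out)       ≈⟨ ⨾-cong {f = 𝒜.F₁ p} (λ _ → refl) (natural-states→out q) ⟨
        𝒜.F₁ p ⨾ (final-η states ⨾ run q)     ≈⟨ assoc (𝒜.F₁ p) (final-η states) (run q) ⟨
        (𝒜.F₁ p ⨾ final-η states) ⨾ run q     ∎
        where open SetoidReasoning (hom-setoid (𝒜.F₀ X) ⊤)

      final-natural : ∀ {X Y} (p : Star (Generator A) X Y) → Natural p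
      final-natural {Y = states}      p       = natural-→states p
      final-natural {Y = out}         p       = natural-→out p
      -- The only arrow into `inp` is its identity.
      final-natural {inp}    {inp}    ε       = natural-ε
      final-natural {inp}    {inp}    (▷ ◅ p) = ⊥-elim (states↛inp p)
      final-natural {states} {inp}    p       = ⊥-elim (states↛inp p)
      final-natural {out}    {inp}    (() ◅ _)

      final-morphism : AutomatonMorphism (ιword A) (language L) 𝒜 final
      final-morphism = record
        { transformation = record { η = final-η ; natural = final-natural }
        ; restrict       = λ where
            inp → transport-cast (𝒜.eq₀ inp)
            out → transport-cast (𝒜.eq₀ out)
        }

      final-morphism-unique : (α : AutomatonMorphism (ιword A) (language L) 𝒜 final) →
                              ∀ X → AutomatonMorphism.η α X ≈ final-η X
      final-morphism-unique α = unique
        where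
        open AutomatonMorphism α
        unique : ∀ X → η X ≈ final-η X
        unique inp    = transport≈id⇒≈cast (𝒜.eq₀ inp) (η inp) (restrict inp)
        unique out    = transport≈id⇒≈cast (𝒜.eq₀ out) (η out) (restrict out)
        -- Naturality of `α` at `p` expresses the composite through `η out`, which is already
        -- determined.
        unique states = states→out-jointly-monic λ p → begin
          η states ⨾ run p         ≈⟨ natural p ⟩
          𝒜.F₁ p ⨾ η out           ≈⟨ ⨾-cong {f = 𝒜.F₁ p} (λ _ → refl) (unique out) ⟩
          𝒜.F₁ p ⨾ final-η out     ≈⟨ natural-states→out p ⟨
          final-η states ⨾ run p   ∎
          where open SetoidReasoning (hom-setoid (𝒜.F₀ states) ⊤)

lemma4p7 : ∀ {c} (em : ExcludedMiddle c) (ext : Extensionality c c)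
    (A B : Set c) (L : Fun A B) →
    Σ[ accepts ∈ (ιword A ⨾F Classical.𝒜final em ext L) ≡F language L ]
    IsTerminal (Auto (ιword A) (language L))
    (automaton (Classical.𝒜final em ext L) accepts)
lemma4p7 em ext A B L = final-accepts em ext L , record
  { !        = final-morphism em ext L
  ; !-unique = λ {𝒜} → final-morphism-unique em ext L 𝒜
  }
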